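{- Let $\textsf{AP}$ be a finite set of atomic propositions containing a proposition $p$. Then $\text{KLTL}\not\leq_{\textit{fin}}\text{HyperCTL}^*$; that is, there exist a finite set of agents $\textsf{Agts}$, a KLTL sentence $\psi$ over $\textsf{Agts}$ and $\textsf{AP}$, and an observation map $\textit{Obs}:\textsf{Agts}\to2^{\textsf{AP}}$ such that for every HyperCTL$^*$ sentence $\varphi$ over $\textsf{AP}$ there is a finite Kripke structure $K$ over $\textsf{AP}$ such that it is not the case that ($K\models\varphi$ iff $(K,\textit{Obs})\models\psi$).
   Context: A Kripke structure over $\textsf{AP}$ is $K=\langle S,s_0,E,V\rangle$ with total transition relation $E\subseteq S\times S$ and valuation $V:S\to2^{\textsf{AP}}$; finite if $S$ is finite; initial paths are infinite $E$-paths from $s_0$. KCTL$^*$: $\varphi::=\top\mid p\mid\neg\varphi\mid\varphi\vee\varphi\mid\textsf{X}\varphi\mid\varphi\textsf{U}\varphi\mid\exists\varphi\mid\textsf{K}_a\varphi$, interpreted on extended structures $(K,\textit{Obs})$ at initial path $\pi$ and position $i$: atoms, Booleans, $\textsf{X}$, $\textsf{U}$ standard; $\exists\varphi$ holds iff some initial $\pi'$ with $\pi'[0,i]=\pi[0,i]$ satisfies $\varphi$ at $i$; $\textsf{K}_a\varphi$ holds iff every initial $\pi'$ with $V(\pi'(j))\cap\textit{Obs}(a)=V(\pi(j))\cap\textit{Obs}(a)$ for all $j\le i$ satisfies $\varphi$ at $i$. $\forall=\neg\exists\neg$, $\textsf{F}\varphi=\top\textsf{U}\varphi$, $\textsf{G}=\neg\textsf{F}\neg$.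 $(K,\textit{Obs})\models\varphi$ iff $\pi,0\models\varphi$ for some initial $\pi$. KLTL is the set of sentences $\forall\varphi$ with $\varphi$ free of path quantifiers. HyperCTL$^*$: $\varphi::=\top\mid p[x]\mid\neg\varphi\mid\varphi\wedge\varphi\mid\textsf{X}\varphi\mid\varphi\textsf{U}\varphi\mid\exists x.\varphi$ with path variables $x$; evaluated at a path assignment $\Pi$ (variables to initial paths), current variable $y$, position $i$: $p[x]$ holds iff $p\in V(\Pi(x)(i))$; $\exists x.\varphi$ holds iff some initial $\pi$ with $\pi[0,i]=\Pi(y)[0,i]$ gives $\Pi[x\leftarrow\pi],x,i\models\varphi$; other cases standard. A sentence has all temporal modalities under a quantifier and all variables bound; $K\models\varphi$ iff $\Pi,y,0\models\varphi$ for some $\Pi,y$. -}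

module Defs where

open import Data.Nat using (ℕ; zero; suc; _≤_; _<_)
open import Data.Fin using (Fin; zero; suc)
open import Data.Fin.Subset using (Subset; _∈_; _∩_)
open import Data.Product using (Σ; Σ-syntax; _×_; _,_; proj₁)
open import Data.Sum using (_⊎_)
open import Data.Unit using (⊤)
open import Data.Empty using (⊥)
open import Relation.Nullary using (¬_)
open import Relation.Binary.PropositionalEquality using (_≡_)
open import Function.Bundles using (_↔_)

-- Kripke structures over AP = Fin n (valuations are subsets of AP)

record Kripke (n : ℕ) : Set₁ where
  field
    S     : Set
    s₀    : S
    E     : S → S → Set
    total : (s : S) → Σ[ s' ∈ S ] E s s'
    V     : S → Subset n
open Kripke public

IsFinite : ∀ {n} → Kripke n → Set
IsFinite K = Σ[ m ∈ ℕ ] (S K ↔ Fin m)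

IsInitPath : ∀ {n} (K : Kripke n) → (ℕ → S K) → Set
IsInitPath K π = (π 0 ≡ s₀ K) × ((i : ℕ) → E K (π i) (π (suc i)))

InitPath : ∀ {n} → Kripke n → Set
InitPath K = Σ[ π ∈ (ℕ → S K) ] IsInitPath K π

SamePrefix : ∀ {n} (K : Kripke n) → InitPath K → InitPath K → ℕ → Set
SamePrefix K π' π i = (j : ℕ) → j ≤ i → proj₁ π' j ≡ proj₁ π j

-- KCTL* over agents Fin k and AP = Fin n

data KForm (k n : ℕ) : Set where
  ⊤ᵏ   : KForm k n
  atomᵏ : Fin n → KForm k n
  ¬ᵏ_  : KForm k n → KForm k n
  _∨ᵏ_ : KForm k n → KForm k n → KForm k n
  Xᵏ   : KForm k n → KForm k n
  _Uᵏ_ : KForm k n → KForm k n → KForm k n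
  ∃ᵏ   : KForm k n → KForm k n
  Kᵏ   : Fin k → KForm k n → KForm k n

∀ᵏ : ∀ {k n} → KForm k n → KForm k n
∀ᵏ φ = ¬ᵏ (∃ᵏ (¬ᵏ φ))

Observation : ℕ → ℕ → Set
Observation k n = Fin k → Subset n

ObsEq : ∀ {k n} (K : Kripke n) → Observation k n → Fin k →
        InitPath K → InitPath K → ℕ → Set
ObsEq K Obs a π' π i =
  (j : ℕ) → j ≤ i → V K (proj₁ π' j) ∩ Obs a ≡ V K (proj₁ π j) ∩ Obs a

satK : ∀ {k n} (K : Kripke n) → Observation k n →
       KForm k n → InitPath K → ℕ → Set
satK K Obs ⊤ᵏ π i = ⊤
satK K Obs (atomᵏ q) π i = q ∈ V K (proj₁ π i)
satK K Obs (¬ᵏ φ) π i = ¬ satK K Obs φ π i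
satK K Obs (φ ∨ᵏ ψ) π i = satK K Obs φ π i ⊎ satK K Obs ψ π i
satK K Obs (Xᵏ φ) π i = satK K Obs φ π (suc i)
satK K Obs (φ Uᵏ ψ) π i =
  Σ[ l ∈ ℕ ] (i ≤ l × satK K Obs ψ π l ×
              ((j : ℕ) → i ≤ j → j < l → satK K Obs φ π j))
satK K Obs (∃ᵏ φ) π i =
  Σ[ π' ∈ InitPath K ] (SamePrefix K π' π i × satK K Obs φ π' i)
satK K Obs (Kᵏ a φ) π i =
  (π' : InitPath K) → ObsEq K Obs a π' π i → satK K Obs φ π' i

_,_⊨ᵏ_ : ∀ {k n} (K : Kripke n) → Observation k n → KForm k n → Set
K , Obs ⊨ᵏ φ = Σ[ π ∈ InitPath K ] satK K Obs φ π 0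

data PathQFree {k n : ℕ} : KForm k n → Set where
  ⊤ᵖ : PathQFree ⊤ᵏ
  atomᵖ : ∀ q → PathQFree (atomᵏ q)
  ¬ᵖ : ∀ {φ} → PathQFree φ → PathQFree (¬ᵏ φ)
  ∨ᵖ : ∀ {φ ψ} → PathQFree φ → PathQFree ψ → PathQFree (φ ∨ᵏ ψ)
  Xᵖ : ∀ {φ} → PathQFree φ → PathQFree (Xᵏ φ)
  Uᵖ : ∀ {φ ψ} → PathQFree φ → PathQFree ψ → PathQFree (φ Uᵏ ψ)
  Kᵖ : ∀ {φ} a → PathQFree φ → PathQFree (Kᵏ a φ)

IsKLTL : ∀ {k n} → KForm k n → Set
IsKLTL {k} {n} ψ = Σ[ φ ∈ KForm k n ] (PathQFree φ × ψ ≡ ∀ᵏ φ)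

-- HyperCTL* over AP = Fin n, path variables as de Bruijn indices:
-- HForm n v has v path variables in scope.

data HForm (n : ℕ) : ℕ → Set where
  ⊤ʰ   : ∀ {v} → HForm n v
  atomʰ : ∀ {v} → Fin n → Fin v → HForm n v
  ¬ʰ_  : ∀ {v} → HForm n v → HForm n v
  _∧ʰ_ : ∀ {v} → HForm n v → HForm n v → HForm n v
  Xʰ   : ∀ {v} → HForm n v → HForm n v
  _Uʰ_ : ∀ {v} → HForm n v → HForm n v → HForm n v
  ∃ʰ   : ∀ {v} → HForm n (suc v) → HForm n v

extend : ∀ {A : Set} {v} → A → (Fin v → A) → Fin (suc v) → A
extend a Π zero = a
extend a Π (suc x) = Π x

-- Π : assignment, cur = Π(y) the path of the current variable
satH : ∀ {n v} (K : Kripke n) → HForm n v →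
       (Fin v → InitPath K) → InitPath K → ℕ → Set
satH K ⊤ʰ Π cur i = ⊤
satH K (atomʰ q x) Π cur i = q ∈ V K (proj₁ (Π x) i)
satH K (¬ʰ φ) Π cur i = ¬ satH K φ Π cur i
satH K (φ ∧ʰ ψ) Π cur i = satH K φ Π cur i × satH K ψ Π cur i
satH K (Xʰ φ) Π cur i = satH K φ Π cur (suc i)
satH K (φ Uʰ ψ) Π cur i =
  Σ[ l ∈ ℕ ] (i ≤ l × satH K ψ Π cur l ×
              ((j : ℕ) → i ≤ j → j < l → satH K φ Π cur j))
satH K (∃ʰ φ) Π cur i =
  Σ[ π ∈ InitPath K ] (SamePrefix K π cur i × satH K φ (extend π Π) π i)

-- sentences: closed (context 0) and every temporal modality under a quantifier
Guarded : ∀ {n} → HForm n 0 → Set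
Guarded ⊤ʰ = ⊤
Guarded (atomʰ q ())
Guarded (¬ʰ φ) = Guarded φ
Guarded (φ ∧ʰ ψ) = Guarded φ × Guarded ψ
Guarded (Xʰ φ) = ⊥
Guarded (φ Uʰ ψ) = ⊥
Guarded (∃ʰ φ) = ⊤

noVars : ∀ {A : Set} → Fin 0 → A
noVars ()

-- K ⊨ φ iff Π, y, 0 ⊨ φ for some Π, y (only Π(y) matters for a closed φ)
_⊨ʰ_ : ∀ {n} (K : Kripke n) → HForm n 0 → Set
K ⊨ʰ φ = Σ[ cur ∈ InitPath K ] satH K φ noVars cur 0

{-# OPTIONS --safe #-}

-- The sentence is ∀ X F K_a ¬p with a blind agent: some level below the root carries no p. The
-- structures have N deterministic branches leaving the root, driven by one word w over ℕ: branch j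
-- carries p at level t + 1 iff w t = j. The words are Toeplitz words: letters 0, …, N − 1, then a
-- hole, periodically, with the holes again filled by such a word, s times, and the remaining holes
-- filled by a constant. With the constant N (a letter of no branch) the sentence holds, with the
-- constant 0 it fails. A HyperCTL* sentence compares fewer than N branches, hence cannot tell N
-- from the letter of an unused branch; and a formula of temporal depth s sees of a word iterated
-- s times only the position in the current block of length (N + 1) ^ s and the letter in its
-- hole, because every kind of smaller block recurs at the start of the next block, which bounds
-- the search for U-witnesses.

module Submission where

open import Defs
open import Data.Nat using (ℕ; zero; suc; _+_; _*_; _∸_; _⊔_; _≤_; _<_; _≤?_; _<?_; z≤n; s≤s)
open import Data.Nat.Properties
open import Data.Nat.DivMod
open import Data.Nat.Divisibility using (divides-refl)
open import Data.Nat.Tactic.RingSolver using (solve-∀)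
open import Data.Fin using (Fin; zero; suc; toℕ; fromℕ<)
open import Data.Fin.Properties as Fin using (toℕ<n; toℕ-injective; toℕ-fromℕ<; any?; all?; injective⇒≤; +↔⊎; *↔×)
open import Data.Fin.Subset using (Subset; ⊥; ⁅_⁆; _∈_)
open import Data.Fin.Subset.Properties using (∉⊥; x∈⁅x⁆; ∩-zeroʳ; _∈?_)
open import Data.Product using (Σ; Σ-syntax; ∃-syntax; _×_; _,_; proj₁; proj₂; map₂)
open import Data.Sum using (_⊎_; inj₁; inj₂)
open import Data.Sum.Function.Propositional using (_⊎-↔_)
open import Data.Sum.Properties using (inj₂-injective)
import Data.Empty as Empty
open import Data.Unit using (⊤; tt)
open import Function using (_∘_; id; const)
open import Function.Bundles using (_⇔_; Equivalence)
open import Function.Construct.Composition using (_↔-∘_)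
open import Function.Construct.Symmetry using (↔-sym)
open import Function.Construct.Identity using (↔-id)
open import Relation.Nullary using (¬_; Dec; yes; no; contradiction; ¬?; _×-dec_; _⊎-dec_; _→-dec_)
open import Relation.Nullary.Decidable using (map′)
open import Relation.Binary.Definitions using (tri<; tri≈; tri>)
open import Relation.Binary.PropositionalEquality using (_≡_; _≢_; refl; sym; trans; cong; subst; subst₂; module ≡-Reasoning)

-- Toeplitz words and their blocks.

module Words (k : ℕ) where

  N b : ℕ
  N = suc k
  b = suc N

  fill : (ℕ → ℕ) → ℕ → ℕ
  fill f t with t % b <? N
  ... | yes _ = t % b
  ... | no  _ = f (t / b)

  fill-digit : ∀ f {r} q → r < N → fill f (r + q * b) ≡ r
  fill-digit f {r} q r<N with (r + q * b) % b <? N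
  ... | yes _ = trans ([m+kn]%n≡m%n r q b) (m<n⇒m%n≡m (m<n⇒m<1+n r<N))
  ... | no ≮N = contradiction (subst (_< N) (sym (trans ([m+kn]%n≡m%n r q b) (m<n⇒m%n≡m (m<n⇒m<1+n r<N)))) r<N) ≮N

  fill-hole : ∀ f q → fill f (N + q * b) ≡ f q
  fill-hole f q with (N + q * b) % b <? N
  ... | yes <N = contradiction (subst (_< N) (trans ([m+kn]%n≡m%n N q b) (m<n⇒m%n≡m (n<1+n N))) <N) (<-irrefl refl)
  ... | no _ = cong f (begin
      (N + q * b) / b      ≡⟨ +-distrib-/-∣ʳ N (divides-refl q) ⟩
      N / b + q * b / b    ≡⟨ cong (_+ q * b / b) (m<n⇒m/n≡0 (n<1+n N)) ⟩
      q * b / b            ≡⟨ m*n/n≡m q b ⟩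
      q                    ∎)
    where open ≡-Reasoning

  -- The recursion acts on the filler, not on the result: a block of size `size (suc s)` is a row of
  -- `b` blocks of size `size s` whose hole letters are spelled by `fill f`.
  toeplitz : ℕ → (ℕ → ℕ) → ℕ → ℕ
  toeplitz zero    f = f
  toeplitz (suc s) f = toeplitz s (fill f)

  -- size s is b to the power s, in the form of a successor, which makes it a NonZero divisor.
  size-1 size : ℕ → ℕ
  size-1 zero    = 0
  size-1 (suc s) = size-1 s + N * suc (size-1 s)
  size s = suc (size-1 s)

  regroup : ∀ x y q M → x + y * M + q * (b * M) ≡ x + (y + q * b) * M
  regroup = lemma b
    where
    lemma : ∀ b x y q M → x + y * M + q * (b * M) ≡ x + (y + q * b) * M
    lemma = solve-∀

  -- `size (suc s)` computes to `b * size s`, so offset `i` from the start of large block `q` falls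
  -- into small block `i / size s + q * b`.
  split : ∀ i q s → i + q * size (suc s) ≡ i % size s + (i / size s + q * b) * size s
  split i q s = trans (cong (_+ q * size (suc s)) (m≡m%n+[m/n]*n i (size s)))
                      (regroup (i % size s) (i / size s) q (size s))

  -- The window consists of one block of size `size (suc s)` and the first `N` small blocks of the
  -- next one.
  block<window : ∀ s → b * size s < (b + N) * size s
  block<window s = *-monoˡ-< (size s) (m<m+n b (s≤s z≤n))

  module _ (κ : ℕ → ℕ) where

    -- After a hole the next N letters are digits again, so agreement in the hole gives a window of
    -- N letters beyond the end of the block.
    fill-window : ∀ f g q q' {r} → κ (f q) ≡ κ (g q') → r < b + N →
                  κ (fill f (r + q * b)) ≡ κ (fill g (r + q' * b))
    fill-window f g q q' {r} e r< with <-cmp r N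
    ... | tri< r<N _ _ = cong κ (trans (fill-digit f q r<N) (sym (fill-digit g q' r<N)))
    ... | tri≈ _ refl _ = trans (cong κ (fill-hole f q)) (trans e (cong κ (sym (fill-hole g q'))))
    ... | tri> _ _ b≤r = cong κ (trans (beyond f q) (sym (beyond g q')))
      where
      d = r ∸ b
      d<N : d < N
      d<N = m<n+o⇒m∸n<o r b r<
      beyond : ∀ f q → fill f (r + q * b) ≡ d
      beyond f q = trans (cong (fill f) (begin
          r + q * b          ≡⟨ cong (_+ q * b) (m∸n+n≡m b≤r) ⟨
          d + b + q * b      ≡⟨ +-assoc d b (q * b) ⟩
          d + suc q * b      ∎)) (fill-digit f (suc q) d<N)
        where open ≡-Reasoning

    -- All letters of a block are forced digits except the one in its hole, which is the letter of
    -- the filler at the index of the block.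
    toeplitz-block : ∀ s f g {o} q q' → o < size s → κ (f q) ≡ κ (g q') →
                     κ (toeplitz s f (o + q * size s)) ≡ κ (toeplitz s g (o + q' * size s))
    toeplitz-block zero f g {zero} q q' _ e =
      trans (cong (κ ∘ f) (*-identityʳ q)) (trans e (cong (κ ∘ g) (sym (*-identityʳ q'))))
    toeplitz-block zero f g {suc o} q q' (s≤s ()) e
    toeplitz-block (suc s) f g {o} q q' o< e
      rewrite split o q s | split o q' s =
      toeplitz-block s (fill f) (fill g) (o / size s + q * b) (o / size s + q' * b) (m%n<n o (size s))
        (fill-window f g q q' e (m<n*o⇒m/o<n (<-trans o< (block<window s))))

  -- With a constant filler all blocks coincide with block 0; here `κ` is the identity.
  toeplitz-periodic : ∀ s a t → toeplitz s (const a) (t % size s) ≡ toeplitz s (const a) t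
  toeplitz-periodic s a t = subst₂ (λ u v → toeplitz s (const a) u ≡ toeplitz s (const a) v)
    (+-identityʳ _) (sym (m≡m%n+[m/n]*n t (size s)))
    (toeplitz-block id s (const a) (const a) 0 (t / size s) (m%n<n t (size s)) refl)

  hole : ℕ → ℕ → ℕ
  hole zero    q = q
  hole (suc s) q = hole s (N + q * b)

  toeplitz-hole : ∀ s f q → toeplitz s f (hole s q) ≡ f q
  toeplitz-hole zero    f q = refl
  toeplitz-hole (suc s) f q = trans (toeplitz-hole s (fill f) (N + q * b)) (fill-hole f q)

  toeplitz-< : ∀ s {f} → (∀ t → f t < N) → ∀ t → toeplitz s f t < N
  toeplitz-< zero    f<N = f<N
  toeplitz-< (suc s) {f} f<N = toeplitz-< s fill<N
    where
    fill<N : ∀ t → fill f t < N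
    fill<N t with t % b <? N
    ... | yes <N = <N
    ... | no  _  = f<N (t / b)

-- Depth measures and the KLTL sentence.

temporalDepth : ∀ {n v} → HForm n v → ℕ
temporalDepth ⊤ʰ          = 0
temporalDepth (atomʰ q x) = 0
temporalDepth (¬ʰ φ)      = temporalDepth φ
temporalDepth (φ ∧ʰ ψ)    = temporalDepth φ ⊔ temporalDepth ψ
temporalDepth (Xʰ φ)      = suc (temporalDepth φ)
temporalDepth (φ Uʰ ψ)    = suc (temporalDepth φ ⊔ temporalDepth ψ)
temporalDepth (∃ʰ φ)      = temporalDepth φ

quantifierDepth : ∀ {n v} → HForm n v → ℕ
quantifierDepth ⊤ʰ          = 0
quantifierDepth (atomʰ q x) = 0
quantifierDepth (¬ʰ φ)      = quantifierDepth φ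
quantifierDepth (φ ∧ʰ ψ)    = quantifierDepth φ ⊔ quantifierDepth ψ
quantifierDepth (Xʰ φ)      = quantifierDepth φ
quantifierDepth (φ Uʰ ψ)    = quantifierDepth φ ⊔ quantifierDepth ψ
quantifierDepth (∃ʰ φ)      = suc (quantifierDepth φ)

-- `Xᵏ` skips the root of the structures below, which carries no `p` and would satisfy the
-- eventuality at once.
eventuallyKnown¬ : ∀ {n} → Fin n → KForm 1 n
eventuallyKnown¬ p = Xᵏ (⊤ᵏ Uᵏ Kᵏ zero (¬ᵏ atomᵏ p))

-- Observing nothing, the agent considers every initial path possible, so knowledge quantifies over
-- a whole level.
blind : ∀ {n} → Observation 1 n
blind _ = ⊥

-- Evaluation on branches driven by one word.

module Branches {n : ℕ} (p : Fin n) (k : ℕ) where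

  open Words k

  label : ℕ → Fin N → Subset n
  label a j with a ≟ toℕ j
  ... | yes _ = ⁅ p ⁆
  ... | no  _ = ⊥

  label-own : ∀ {a} {j : Fin N} → a ≡ toℕ j → p ∈ label a j
  label-own {a} {j} e with a ≟ toℕ j
  ... | yes _ = x∈⁅x⁆ p
  ... | no ≢  = contradiction e ≢

  label-other : ∀ {a} {j : Fin N} {x} → a ≢ toℕ j → ¬ x ∈ label a j
  label-other {a} {j} ≢ with a ≟ toℕ j
  ... | yes e = contradiction e ≢
  ... | no _  = ∉⊥

  -- A path quantifier evaluated after the first step can only rebind the current branch.
  sat₊ : ∀ {v} → (ℕ → ℕ) → HForm n v → (Fin v → Fin N) → Fin N → ℕ → Set
  sat₊ w ⊤ʰ          Π c t = ⊤
  sat₊ w (atomʰ q x) Π c t = q ∈ label (w t) (Π x)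
  sat₊ w (¬ʰ φ)      Π c t = ¬ sat₊ w φ Π c t
  sat₊ w (φ ∧ʰ ψ)    Π c t = sat₊ w φ Π c t × sat₊ w ψ Π c t
  sat₊ w (Xʰ φ)      Π c t = sat₊ w φ Π c (suc t)
  sat₊ w (φ Uʰ ψ)    Π c t =
    Σ[ l ∈ ℕ ] (t ≤ l × sat₊ w ψ Π c l × (∀ j → t ≤ j → j < l → sat₊ w φ Π c j))
  sat₊ w (∃ʰ φ)      Π c t = sat₊ w φ (extend c Π) c t

  -- Indistinguishable positions, up to a quotient of the letters.

  module Transfer (κ : ℕ → ℕ) (covers : ∀ a → ∃[ r ] (r < N × κ a ≡ κ r)) where

    Visible : Fin N → Set
    Visible j = ∀ a a' → κ a ≡ κ a' → label a j ≡ label a' j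

    extend-visible : ∀ {v} {Π : Fin v → Fin N} {c} → Visible c → (∀ x → Visible (Π x)) →
                     ∀ x → Visible (extend c Π x)
    extend-visible vc vΠ zero    = vc
    extend-visible vc vΠ (suc x) = vΠ x

    -- Induction on the formula together with `s`: a temporal operator spends one level, passing
    -- from a block to the smaller blocks around it. Negation exchanges `f` and `g`.
    transfer : ∀ {v} s (φ : HForm n v) → temporalDepth φ ≤ s →
               ∀ {Π c} → (∀ x → Visible (Π x)) → Visible c →
               ∀ f g {o} q q' → o < size s → κ (f q) ≡ κ (g q') →
               sat₊ (toeplitz s f) φ Π c (o + q * size s) →
               sat₊ (toeplitz s g) φ Π c (o + q' * size s)

    -- Every small block of the window has hole letters of the same class in both words, by
    -- `fill-window`, so `transfer` applies to it one level down.
    transfer-window : ∀ {v} s (φ : HForm n v) → temporalDepth φ ≤ s →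
                      ∀ {Π c} → (∀ x → Visible (Π x)) → Visible c →
                      ∀ f g q q' → κ (f q) ≡ κ (g q') → ∀ i → i < (b + N) * size s →
                      sat₊ (toeplitz (suc s) f) φ Π c (i + q * size (suc s)) →
                      sat₊ (toeplitz (suc s) g) φ Π c (i + q' * size (suc s))

    transfer s ⊤ʰ d vΠ vc f g q q' o< e _ = tt
    transfer s (atomʰ x y) d vΠ vc f g q q' o< e =
      subst (x ∈_) (vΠ y _ _ (toeplitz-block κ s f g q q' o< e))
    transfer s (¬ʰ φ) d vΠ vc f g q q' o< e ¬φ φ' =
      ¬φ (transfer s φ d vΠ vc g f q' q o< (sym e) φ')
    transfer s (φ ∧ʰ ψ) d vΠ vc f g q q' o< e (sφ , sψ) =
      transfer s φ (m⊔n≤o⇒m≤o _ _ d) vΠ vc f g q q' o< e sφ ,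
      transfer s ψ (m⊔n≤o⇒n≤o _ _ d) vΠ vc f g q q' o< e sψ
    transfer s (∃ʰ φ) d vΠ vc f g q q' o< e =
      transfer s φ d (extend-visible vc vΠ) vc f g q q' o< e
    transfer (suc s) (Xʰ φ) (s≤s d) vΠ vc f g {o} q q' o< e =
      transfer-window s φ d vΠ vc f g q q' e (suc o) (≤-<-trans o< (block<window s))
    transfer (suc s) (φ Uʰ ψ) (s≤s d) {Π} {c} vΠ vc f g {o} q q' o< e (l , n≤l , ψl , φ<l) =
      -- A witness inside the window keeps its offset; a later one is replaced by one inside the
      -- window.
      until (l <? (b + N) * size s + Q)
      where
      Q Q' : ℕ
      Q  = q * size (suc s)
      Q' = q' * size (suc s)
      -- Since `i + Q ≤ l`, the formula `φ` holds in the first word at all offsets from `o` up to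
      -- `i`, and these facts transfer.
      stop : ∀ i → o ≤ i → i < (b + N) * size s → i + Q ≤ l →
             sat₊ (toeplitz (suc s) g) ψ Π c (i + Q') →
             sat₊ (toeplitz (suc s) g) (φ Uʰ ψ) Π c (o + Q')
      stop i o≤i i< i≤l ψi = i + Q' , +-monoˡ-≤ Q' o≤i , ψi , before
        where
        before : ∀ j → o + Q' ≤ j → j < i + Q' → sat₊ (toeplitz (suc s) g) φ Π c j
        before j ≤j j< = subst (sat₊ (toeplitz (suc s) g) φ Π c) j≡
          (transfer-window s φ (m⊔n≤o⇒m≤o _ _ d) vΠ vc f g q q' e j' (<-trans j'<i i<)
            (φ<l (j' + Q) (+-monoˡ-≤ Q (m+n≤o⇒m≤o∸n o ≤j)) (<-≤-trans (+-monoˡ-< Q j'<i) i≤l)))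
          where
          j' = j ∸ Q'
          j≡ : j' + Q' ≡ j
          j≡ = m∸n+n≡m (≤-trans (m≤n+m Q' o) ≤j)
          j'<i : j' < i
          j'<i = +-cancelʳ-< Q' _ _ (subst (_< i + Q') (sym j≡) j<)
      until : Dec (l < (b + N) * size s + Q) → sat₊ (toeplitz (suc s) g) (φ Uʰ ψ) Π c (o + Q')
      until (yes near) = stop i (m+n≤o⇒m≤o∸n o n≤l) i< (≤-reflexive l≡)
        (transfer-window s ψ (m⊔n≤o⇒n≤o _ _ d) vΠ vc f g q q' e i i<
          (subst (sat₊ (toeplitz (suc s) f) ψ Π c) (sym l≡) ψl))
        where
        i = l ∸ Q
        l≡ : i + Q ≡ l
        l≡ = m∸n+n≡m (≤-trans (m≤n+m Q o) n≤l)
        i< : i < (b + N) * size s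
        i< = +-cancelʳ-< Q _ _ (subst (_< (b + N) * size s + Q) (sym l≡) near)
      -- The block of size s containing a far witness also occurs among the first N blocks of the
      -- next block of size suc s.
      until (no far) with r , r<N , κ≡ ← covers (fill f (l / size s)) =
        stop i (≤-trans (<⇒≤ o<) (≤-trans (*-monoˡ-≤ (size s) (m≤m+n b r)) (m≤n+m _ (l % size s))))
          i< (≤-trans (+-monoˡ-≤ Q (<⇒≤ i<)) (≮⇒≥ far))
          (subst (sat₊ (toeplitz (suc s) g) ψ Π c) (sym (regroup (l % size s) (b + r) q' (size s)))
            (transfer s ψ (m⊔n≤o⇒n≤o _ _ d) vΠ vc (fill f) (fill g) (l / size s) (b + r + q' * b)
              (m%n<n l (size s))
              (trans κ≡ (cong κ (sym (trans (cong (fill g) digit≡) (fill-digit g (suc q') r<N)))))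
              (subst (sat₊ (toeplitz (suc s) f) ψ Π c) (m≡m%n+[m/n]*n l (size s)) ψl)))
        where
        i = l % size s + (b + r) * size s
        i< : i < (b + N) * size s
        i< = <-≤-trans (+-monoˡ-< ((b + r) * size s) (m%n<n l (size s)))
               (*-monoˡ-≤ (size s) (+-monoʳ-< b r<N))
        digit≡ : b + r + q' * b ≡ r + suc q' * b
        digit≡ = trans (cong (_+ q' * b) (+-comm b r)) (+-assoc r b (q' * b))

    transfer-window s φ d vΠ vc f g q q' e i i<
      rewrite split i q s | split i q' s =
      transfer s φ d vΠ vc (fill f) (fill g) (i / size s + q * b) (i / size s + q' * b) (m%n<n i (size s))
        (fill-window κ f g q q' e (m<n*o⇒m/o<n i<))

    -- Periodicity and decidability for a constant filler.

    shift : ∀ {v} s (φ : HForm n v) → temporalDepth φ ≤ s →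
            ∀ {Π c} → (∀ x → Visible (Π x)) → Visible c →
            ∀ a {t u} → t % size s ≡ u % size s →
            sat₊ (toeplitz s (const a)) φ Π c t → sat₊ (toeplitz s (const a)) φ Π c u
    shift s φ d {Π} {c} vΠ vc a {t} {u} t≡u φt =
      subst (sat₊ (toeplitz s (const a)) φ Π c)
        (trans (cong (_+ u / size s * size s) t≡u) (sym (m≡m%n+[m/n]*n u (size s))))
        (transfer s φ d vΠ vc (const a) (const a) (t / size s) (u / size s) (m%n<n t (size s)) refl
          (subst (sat₊ (toeplitz s (const a)) φ Π c) (m≡m%n+[m/n]*n t (size s)) φt))

    -- Truth has period `size s`, so the search for a witness of `_Uʰ_` is bounded. Decidability
    -- lets the final choice between the two structures be made constructively.
    sat₊? : ∀ {v} s a (φ : HForm n v) → temporalDepth φ ≤ s →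
            ∀ {Π c} → (∀ x → Visible (Π x)) → Visible c →
            ∀ t → Dec (sat₊ (toeplitz s (const a)) φ Π c t)
    sat₊? s a ⊤ʰ d vΠ vc t = yes tt
    sat₊? s a (atomʰ q x) d {Π} vΠ vc t = q ∈? label (toeplitz s (const a) t) (Π x)
    sat₊? s a (¬ʰ φ) d vΠ vc t = ¬? (sat₊? s a φ d vΠ vc t)
    sat₊? s a (φ ∧ʰ ψ) d vΠ vc t =
      sat₊? s a φ (m⊔n≤o⇒m≤o _ _ d) vΠ vc t ×-dec sat₊? s a ψ (m⊔n≤o⇒n≤o _ _ d) vΠ vc t
    sat₊? s a (Xʰ φ) d vΠ vc t = sat₊? s a φ (<⇒≤ d) vΠ vc (suc t)
    sat₊? s a (∃ʰ φ) d vΠ vc t = sat₊? s a φ d (extend-visible vc vΠ) vc t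
    sat₊? s a (φ Uʰ ψ) d {Π} {c} vΠ vc t =
      map′ (λ (l , _ , t≤l , ψl , φ<l) → l , t≤l , ψl , λ j t≤j j<l → φ<l j<l t≤j) bounded
        (anyUpTo? (λ l → t ≤? l ×-dec sat₊? s a ψ dψ vΠ vc l
                         ×-dec allUpTo? (λ j → t ≤? j →-dec sat₊? s a φ dφ vΠ vc j) l)
                  (t + size s))
      where
      w = toeplitz s (const a)
      dφ = m⊔n≤o⇒m≤o _ _ (<⇒≤ d)
      dψ = m⊔n≤o⇒n≤o _ _ (<⇒≤ d)
      bounded : sat₊ w (φ Uʰ ψ) Π c t →
                ∃[ l ] (l < t + size s × t ≤ l × sat₊ w ψ Π c l ×
                        (∀ {j} → j < l → t ≤ j → sat₊ w φ Π c j))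
      bounded (l , t≤l , ψl , φ<l) =
        -- Going back from `l` by whole periods preserves `ψ` and only shortens the stretch on which
        -- `φ` is required.
        l' , +-monoʳ-< t (m%n<n m (size s)) , m≤m+n t _ ,
        shift s ψ dψ vΠ vc a l≡l' ψl , λ j<l' t≤j → φ<l _ t≤j (<-≤-trans j<l' l'≤l)
        where
        m = l ∸ t
        l' = t + m % size s
        l'≤l : l' ≤ l
        l'≤l = ≤-trans (+-monoʳ-≤ t (m%n≤m m (size s))) (≤-reflexive (m+[n∸m]≡n t≤l))
        l≡ : l ≡ l' + m / size s * size s
        l≡ = begin
          l                                           ≡⟨ m+[n∸m]≡n t≤l ⟨
          t + m                                       ≡⟨ cong (t +_) (m≡m%n+[m/n]*n m (size s)) ⟩
          t + (m % size s + m / size s * size s)      ≡⟨ +-assoc t _ _ ⟨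
          l' + m / size s * size s                    ∎
          where open ≡-Reasoning
        l≡l' : l % size s ≡ l' % size s
        l≡l' = trans (cong (_% size s) l≡) ([m+kn]%n≡m%n l' (m / size s) (size s))

  -- Evaluation at the root.

  -- Position 0 is the root, the only state where a quantifier has a choice.
  sat₀ : ∀ {v} → (ℕ → ℕ) → HForm n v → (Fin v → Fin N) → Fin N → Set
  sat₀ w ⊤ʰ          Π c = ⊤
  sat₀ w (atomʰ q x) Π c = Empty.⊥
  sat₀ w (¬ʰ φ)      Π c = ¬ sat₀ w φ Π c
  sat₀ w (φ ∧ʰ ψ)    Π c = sat₀ w φ Π c × sat₀ w ψ Π c
  sat₀ w (Xʰ φ)      Π c = sat₊ w φ Π c 0
  sat₀ w (φ Uʰ ψ)    Π c = sat₀ w ψ Π c ⊎ (sat₀ w φ Π c × sat₊ w (φ Uʰ ψ) Π c 0)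
  sat₀ w (∃ʰ φ)      Π c = Σ[ j ∈ Fin N ] sat₀ w φ (extend j Π) j

  collapse : Fin N → ℕ → ℕ
  collapse r a with a <? N
  ... | yes _ = a
  ... | no  _ = toℕ r

  collapse-< : ∀ r a → collapse r a < N
  collapse-< r a with a <? N
  ... | yes a<N = a<N
  ... | no  _   = toℕ<n r

  collapse-fixes : ∀ r {a} → a < N → collapse r a ≡ a
  collapse-fixes r {a} a<N with a <? N
  ... | yes _ = refl
  ... | no ≮N = contradiction a<N ≮N

  collapse-covers : ∀ r a → ∃[ d ] (d < N × collapse r a ≡ collapse r d)
  collapse-covers r a = collapse r a , collapse-< r a , sym (collapse-fixes r (collapse-< r a))

  collapse-reflects : ∀ r j a → r ≢ j → collapse r a ≡ toℕ j → a ≡ toℕ j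
  collapse-reflects r j a r≢j e with a <? N
  ... | yes _ = e
  ... | no  _ = contradiction (toℕ-injective e) r≢j

  -- The only letters merged are `r` and those from `N` on, and a branch other than `r` is labelled
  -- `⊥` under each of them.
  collapse-label : ∀ r j → r ≢ j → ∀ a a' → collapse r a ≡ collapse r a' → label a j ≡ label a' j
  collapse-label r j r≢j a a' e with a ≟ toℕ j | a' ≟ toℕ j
  ... | yes _ | yes _ = refl
  ... | no  _ | no  _ = refl
  ... | yes refl | no ≢ =
    contradiction (collapse-reflects r j a' r≢j (trans (sym e) (collapse-fixes r (toℕ<n j)))) ≢
  ... | no ≢ | yes refl =
    contradiction (collapse-reflects r j a r≢j (trans e (collapse-fixes r (toℕ<n j)))) ≢

  -- Pigeonhole: if `f` hit every element, choosing preimages would inject `Fin N` into `Fin m`.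
  fresh : ∀ {m} (f : Fin m → Fin N) → m < N → ∃[ r ] (∀ x → r ≢ f x)
  fresh {m} f m<N with any? (λ r → all? (λ x → ¬? (r Fin.≟ f x)))
  ... | yes ∃r = ∃r
  ... | no ¬∃r = contradiction (injective⇒≤ preimage-injective) (<⇒≱ m<N)
    where
    preimage : ∀ r → ∃[ x ] r ≡ f x
    preimage r with any? (λ x → r Fin.≟ f x)
    ... | yes ∃x = ∃x
    ... | no ¬∃x = contradiction (r , λ x r≡ → ¬∃x (x , r≡)) ¬∃r
    preimage-injective : ∀ {r r'} → proj₁ (preimage r) ≡ proj₁ (preimage r') → r ≡ r'
    preimage-injective {r} {r'} e =
      trans (proj₂ (preimage r)) (trans (cong f e) (sym (proj₂ (preimage r'))))

  module _ {v} (Π : Fin v → Fin N) (c : Fin N) (v<N : suc v < N) where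

    private
      r = proj₁ (fresh (extend c Π) v<N)
      r≢ = proj₂ (fresh (extend c Π) v<N)
      open Transfer (collapse r) (collapse-covers r)

    -- The extra level removes any condition on `f` and `g`: the first block of size `size s` has
    -- the digit 0 in its hole in both words.
    transfer-start : ∀ s (φ : HForm n v) → temporalDepth φ ≤ s → ∀ f g →
                     sat₊ (toeplitz (suc s) f) φ Π c 0 → sat₊ (toeplitz (suc s) g) φ Π c 0
    transfer-start s φ d f g =
      transfer s φ d (λ x → collapse-label r (Π x) (r≢ (suc x))) (collapse-label r c (r≢ zero))
        (fill f) (fill g) {0} 0 0 (s≤s z≤n) refl

    start? : ∀ s a (φ : HForm n v) → temporalDepth φ ≤ s → Dec (sat₊ (toeplitz s (const a)) φ Π c 0)
    start? s a φ d =
      sat₊? s a φ d (λ x → collapse-label r (Π x) (r≢ (suc x))) (collapse-label r c (r≢ zero)) 0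

  ⊔-boundˡ : ∀ v x y → suc v + (x ⊔ y) < N → suc v + x < N
  ⊔-boundˡ v x y = ≤-<-trans (+-monoʳ-≤ (suc v) (m≤m⊔n x y))

  ⊔-boundʳ : ∀ v x y → suc v + (x ⊔ y) < N → suc v + y < N
  ⊔-boundʳ v x y = ≤-<-trans (+-monoʳ-≤ (suc v) (m≤n⊔m x y))

  var-bound : ∀ v x → suc v + x < N → suc v < N
  var-bound v x = ≤-<-trans (m≤m+n (suc v) x)

  ∃-bound : ∀ v x → suc v + suc x < N → suc (suc v) + x < N
  ∃-bound v x = subst (_< N) (+-suc (suc v) x)

  sat₀-transfer : ∀ {v} s (φ : HForm n v) → temporalDepth φ ≤ s → suc v + quantifierDepth φ < N →
                  ∀ Π c f g → sat₀ (toeplitz (suc s) f) φ Π c → sat₀ (toeplitz (suc s) g) φ Π c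
  sat₀-transfer s ⊤ʰ d e Π c f g _ = tt
  sat₀-transfer s (¬ʰ φ) d e Π c f g ¬φ φ' = ¬φ (sat₀-transfer s φ d e Π c g f φ')
  sat₀-transfer {v} s (φ ∧ʰ ψ) d e Π c f g (sφ , sψ) =
    sat₀-transfer s φ (m⊔n≤o⇒m≤o _ _ d) (⊔-boundˡ v _ _ e) Π c f g sφ ,
    sat₀-transfer s ψ (m⊔n≤o⇒n≤o _ _ d) (⊔-boundʳ v _ _ e) Π c f g sψ
  sat₀-transfer {v} s (Xʰ φ) d e Π c f g =
    transfer-start Π c (var-bound v _ e) s φ (<⇒≤ d) f g
  sat₀-transfer {v} s (φ Uʰ ψ) d e Π c f g (inj₁ sψ) =
    inj₁ (sat₀-transfer s ψ (m⊔n≤o⇒n≤o _ _ (<⇒≤ d)) (⊔-boundʳ v _ _ e) Π c f g sψ)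
  sat₀-transfer {v} s (φ Uʰ ψ) d e Π c f g (inj₂ (sφ , sU)) =
    inj₂ (sat₀-transfer s φ (m⊔n≤o⇒m≤o _ _ (<⇒≤ d)) (⊔-boundˡ v _ _ e) Π c f g sφ ,
          transfer-start Π c (var-bound v _ e) s (φ Uʰ ψ) d f g sU)
  sat₀-transfer {v} s (∃ʰ φ) d e Π c f g (j , sφ) =
    j , sat₀-transfer s φ d (∃-bound v _ e) (extend j Π) j f g sφ

  sat₀? : ∀ {v} s a (φ : HForm n v) → temporalDepth φ ≤ s → suc v + quantifierDepth φ < N →
          ∀ Π c → Dec (sat₀ (toeplitz s (const a)) φ Π c)
  sat₀? s a ⊤ʰ d e Π c = yes tt
  sat₀? s a (atomʰ q x) d e Π c = no λ ()
  sat₀? s a (¬ʰ φ) d e Π c = ¬? (sat₀? s a φ d e Π c)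
  sat₀? {v} s a (φ ∧ʰ ψ) d e Π c =
    sat₀? s a φ (m⊔n≤o⇒m≤o _ _ d) (⊔-boundˡ v _ _ e) Π c ×-dec
    sat₀? s a ψ (m⊔n≤o⇒n≤o _ _ d) (⊔-boundʳ v _ _ e) Π c
  sat₀? {v} s a (Xʰ φ) d e Π c = start? Π c (var-bound v _ e) s a φ (<⇒≤ d)
  sat₀? {v} s a (φ Uʰ ψ) d e Π c =
    sat₀? s a ψ (m⊔n≤o⇒n≤o _ _ (<⇒≤ d)) (⊔-boundʳ v _ _ e) Π c ⊎-dec
    (sat₀? s a φ (m⊔n≤o⇒m≤o _ _ (<⇒≤ d)) (⊔-boundˡ v _ _ e) Π c ×-dec
     start? Π c (var-bound v _ e) s a (φ Uʰ ψ) d)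
  sat₀? {v} s a (∃ʰ φ) d e Π c =
    any? (λ j → sat₀? s a φ d (∃-bound v _ e) (extend j Π) j)

  -- The finite Kripke structure of a periodic word.

  module Structure (w : ℕ → ℕ) (L-1 : ℕ) (periodic : ∀ t → w (t % suc L-1) ≡ w t) where

    L : ℕ
    L = suc L-1

    State : Set
    State = Fin 1 ⊎ (Fin N × Fin L)

    pattern root = inj₁ zero

    -- The state of branch `j` at path position `suc t`, as the root occupies position 0.
    at : Fin N → ℕ → State
    at j t = inj₂ (j , t mod L)

    Edge : State → State → Set
    Edge (inj₁ _)       (inj₁ _)         = Empty.⊥
    Edge (inj₁ _)       (inj₂ (j , τ))   = τ ≡ zero
    Edge (inj₂ _)       (inj₁ _)         = Empty.⊥
    Edge (inj₂ (j , τ)) (inj₂ (j' , τ')) = j' ≡ j × τ' ≡ suc (toℕ τ) mod L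

    edge-total : ∀ s → Σ[ s' ∈ State ] Edge s s'
    edge-total (inj₁ _)       = inj₂ (zero , zero) , refl
    edge-total (inj₂ (j , τ)) = inj₂ (j , suc (toℕ τ) mod L) , refl , refl

    valuation : State → Subset n
    valuation (inj₁ _)       = ⊥
    valuation (inj₂ (j , τ)) = label (w (toℕ τ)) j

    K : Kripke n
    K = record { S = State ; s₀ = root ; E = Edge ; total = edge-total ; V = valuation }

    finite : IsFinite K
    finite = 1 + N * L , ↔-sym ((↔-id (Fin 1) ⊎-↔ *↔×) ↔-∘ +↔⊎)

    toℕ-mod : ∀ t → toℕ (t mod L) ≡ t % L
    toℕ-mod t = toℕ-fromℕ< (m%n<n t L)

    valuation-at : ∀ j t → valuation (at j t) ≡ label (w t) j
    valuation-at j t = cong (λ a → label a j) (trans (cong w (toℕ-mod t)) (periodic t))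

    suc-mod : ∀ t → suc (toℕ (t mod L)) mod L ≡ suc t mod L
    suc-mod t = toℕ-injective (begin
        toℕ (suc (toℕ (t mod L)) mod L)     ≡⟨ toℕ-mod (suc (toℕ (t mod L))) ⟩
        suc (toℕ (t mod L)) % L             ≡⟨ cong (λ m → suc m % L) (toℕ-mod t) ⟩
        suc (t % L) % L                     ≡⟨ [m+kn]%n≡m%n (suc (t % L)) (t / L) L ⟨
        (suc (t % L) + t / L * L) % L       ≡⟨ cong (λ m → suc m % L) (m≡m%n+[m/n]*n t L) ⟨
        suc t % L                           ≡⟨ toℕ-mod (suc t) ⟨
        toℕ (suc t mod L)                   ∎)
      where open ≡-Reasoning

    run : Fin N → InitPath K
    run j = path , refl , step
      where
      path : ℕ → State
      path zero    = root
      path (suc t) = at j t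
      step : ∀ i → Edge (path i) (path (suc i))
      step zero    = refl
      step (suc t) = refl , sym (suc-mod t)

    OnBranch : InitPath K → Fin N → Set
    OnBranch π j = ∀ t → proj₁ π (suc t) ≡ at j t

    first-step : ∀ {s s'} → s ≡ root → Edge s s' → ∃[ j ] s' ≡ at j 0
    first-step {s' = inj₂ (j , _)} refl refl = j , refl

    next-step : ∀ {s s'} j t → s ≡ at j t → Edge s s' → s' ≡ at j (suc t)
    next-step {s' = inj₂ _} j t refl (refl , refl) = cong (λ τ → inj₂ (j , τ)) (suc-mod t)

    -- Only the first edge offers a choice; all later ones are deterministic.
    branch : ∀ π → ∃[ j ] OnBranch π j
    branch (π , start , step) = j , on
      where
      j = proj₁ (first-step start (step 0))
      on : ∀ t → π (suc t) ≡ at j t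
      on zero    = proj₂ (first-step start (step 0))
      on (suc t) = next-step j t (on t) (step (suc t))

    at-injective : ∀ {j j'} t → at j t ≡ at j' t → j ≡ j'
    at-injective t e = cong proj₁ (inj₂-injective e)

    label-on : ∀ {π j} → OnBranch π j → ∀ t → valuation (proj₁ π (suc t)) ≡ label (w t) j
    label-on {j = j} on t = trans (cong valuation (on t)) (valuation-at j t)

    extend-on : ∀ {v} {Π : Fin v → InitPath K} {Π' π c} → OnBranch π c →
                (∀ x → OnBranch (Π x) (Π' x)) → ∀ x → OnBranch (extend π Π x) (extend c Π' x)
    extend-on onπ onΠ zero    = onπ
    extend-on onπ onΠ (suc x) = onΠ x

    -- HyperCTL* semantics of the structure as evaluation on the word.

    satH⇒sat₊ : ∀ {v} (φ : HForm n v) {Π Π' cur c} → (∀ x → OnBranch (Π x) (Π' x)) →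
                OnBranch cur c → ∀ t → satH K φ Π cur (suc t) → sat₊ w φ Π' c t
    sat₊⇒satH : ∀ {v} (φ : HForm n v) {Π Π' cur c} → (∀ x → OnBranch (Π x) (Π' x)) →
                OnBranch cur c → ∀ t → sat₊ w φ Π' c t → satH K φ Π cur (suc t)

    satH⇒sat₊ ⊤ʰ onΠ on t _ = tt
    satH⇒sat₊ (atomʰ q x) {Π} onΠ on t = subst (q ∈_) (label-on {Π x} (onΠ x) t)
    satH⇒sat₊ (¬ʰ φ) onΠ on t ¬φ φt = ¬φ (sat₊⇒satH φ onΠ on t φt)
    satH⇒sat₊ (φ ∧ʰ ψ) onΠ on t (φt , ψt) = satH⇒sat₊ φ onΠ on t φt , satH⇒sat₊ ψ onΠ on t ψt
    satH⇒sat₊ (Xʰ φ) onΠ on t = satH⇒sat₊ φ onΠ on (suc t)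
    satH⇒sat₊ (φ Uʰ ψ) onΠ on t (suc l , s≤s t≤l , ψl , φ<l) =
      l , t≤l , satH⇒sat₊ ψ onΠ on l ψl ,
      λ j t≤j j<l → satH⇒sat₊ φ onΠ on j (φ<l (suc j) (s≤s t≤j) (s≤s j<l))
    -- The common prefix includes position 1, whose state already determines the branch.
    satH⇒sat₊ (∃ʰ φ) {c = c} onΠ on t (π , same , φπ) with j , onπ ← branch π
      with refl ← at-injective 0 (trans (sym (onπ 0)) (trans (same 1 (s≤s z≤n)) (on 0))) =
      satH⇒sat₊ φ (extend-on onπ onΠ) onπ t φπ

    sat₊⇒satH ⊤ʰ onΠ on t _ = tt
    sat₊⇒satH (atomʰ q x) {Π} onΠ on t = subst (q ∈_) (sym (label-on {Π x} (onΠ x) t))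
    sat₊⇒satH (¬ʰ φ) onΠ on t ¬φ φt = ¬φ (satH⇒sat₊ φ onΠ on t φt)
    sat₊⇒satH (φ ∧ʰ ψ) onΠ on t (φt , ψt) = sat₊⇒satH φ onΠ on t φt , sat₊⇒satH ψ onΠ on t ψt
    sat₊⇒satH (Xʰ φ) onΠ on t = sat₊⇒satH φ onΠ on (suc t)
    sat₊⇒satH (φ Uʰ ψ) onΠ on t (l , t≤l , ψl , φ<l) =
      suc l , s≤s t≤l , sat₊⇒satH ψ onΠ on l ψl ,
      λ { (suc j) (s≤s t≤j) (s≤s j<l) → sat₊⇒satH φ onΠ on j (φ<l j t≤j j<l) }
    sat₊⇒satH (∃ʰ φ) {cur = cur} onΠ on t φt =
      cur , (λ _ _ → refl) , sat₊⇒satH φ (extend-on on onΠ) on t φt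

    satH⇒sat₀ : ∀ {v} (φ : HForm n v) {Π Π' cur c} → (∀ x → OnBranch (Π x) (Π' x)) →
                OnBranch cur c → satH K φ Π cur 0 → sat₀ w φ Π' c
    sat₀⇒satH : ∀ {v} (φ : HForm n v) {Π Π' cur c} → (∀ x → OnBranch (Π x) (Π' x)) →
                OnBranch cur c → sat₀ w φ Π' c → satH K φ Π cur 0

    satH⇒sat₀ ⊤ʰ onΠ on _ = tt
    satH⇒sat₀ (atomʰ q x) {Π} onΠ on q∈ =
      ∉⊥ (subst (λ s → q ∈ valuation s) (proj₁ (proj₂ (Π x))) q∈)
    satH⇒sat₀ (¬ʰ φ) onΠ on ¬φ φ₀ = ¬φ (sat₀⇒satH φ onΠ on φ₀)
    satH⇒sat₀ (φ ∧ʰ ψ) onΠ on (φ₀ , ψ₀) = satH⇒sat₀ φ onΠ on φ₀ , satH⇒sat₀ ψ onΠ on ψ₀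
    satH⇒sat₀ (Xʰ φ) onΠ on = satH⇒sat₊ φ onΠ on 0
    satH⇒sat₀ (φ Uʰ ψ) onΠ on (zero , _ , ψ₀ , _) = inj₁ (satH⇒sat₀ ψ onΠ on ψ₀)
    satH⇒sat₀ (φ Uʰ ψ) onΠ on (suc l , _ , ψl , φ<l) =
      inj₂ (satH⇒sat₀ φ onΠ on (φ<l 0 z≤n (s≤s z≤n)) ,
            satH⇒sat₊ (φ Uʰ ψ) onΠ on 0 (suc l , s≤s z≤n , ψl , λ j _ → φ<l j z≤n))
    satH⇒sat₀ (∃ʰ φ) onΠ on (π , _ , φπ) with j , onπ ← branch π =
      j , satH⇒sat₀ φ (extend-on onπ onΠ) onπ φπ

    sat₀⇒satH ⊤ʰ onΠ on _ = tt
    sat₀⇒satH (¬ʰ φ) onΠ on ¬φ φ₀ = ¬φ (satH⇒sat₀ φ onΠ on φ₀)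
    sat₀⇒satH (φ ∧ʰ ψ) onΠ on (φ₀ , ψ₀) = sat₀⇒satH φ onΠ on φ₀ , sat₀⇒satH ψ onΠ on ψ₀
    sat₀⇒satH (Xʰ φ) onΠ on = sat₊⇒satH φ onΠ on 0
    sat₀⇒satH (φ Uʰ ψ) onΠ on (inj₁ ψ₀) = 0 , z≤n , sat₀⇒satH ψ onΠ on ψ₀ , λ _ _ ()
    sat₀⇒satH (φ Uʰ ψ) {Π} {cur = cur} onΠ on (inj₂ (φ₀ , U₀))
      with l , 1≤l , ψl , φ<l ← sat₊⇒satH (φ Uʰ ψ) onΠ on 0 U₀ = l , z≤n , ψl , before φ<l
      where
      before : ∀ {l} → (∀ j → 1 ≤ j → j < l → satH K φ Π cur j) →
               ∀ j → 0 ≤ j → j < l → satH K φ Π cur j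
      before φ<l zero    _ _   = sat₀⇒satH φ onΠ on φ₀
      before φ<l (suc j) _ j<l = φ<l (suc j) (s≤s z≤n) j<l
    sat₀⇒satH (∃ʰ φ) {cur = cur} onΠ on (j , φ₀) =
      run j , same-root , sat₀⇒satH φ (extend-on {π = run j} (λ _ → refl) onΠ) (λ _ → refl) φ₀
      where
      same-root : SamePrefix K (run j) cur 0
      same-root .zero z≤n = sym (proj₁ (proj₂ cur))

    ⊨ʰ⇒sat₀ : ∀ φ → K ⊨ʰ φ → ∃[ c ] sat₀ w φ noVars c
    ⊨ʰ⇒sat₀ φ (cur , φcur) with c , on ← branch cur = c , satH⇒sat₀ φ (λ ()) on φcur

    sat₀⇒⊨ʰ : ∀ φ → ∃[ c ] sat₀ w φ noVars c → K ⊨ʰ φ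
    sat₀⇒⊨ʰ φ (c , φc) = run c , sat₀⇒satH φ (λ ()) (λ _ → refl) φc

    -- The KLTL sentence on the structure.

    gap⇒⊨ᵏ : ∀ t → w t ≡ N → K , blind ⊨ᵏ ∀ᵏ (eventuallyKnown¬ p)
    -- The starting path is arbitrary: `∀ᵏ` at the root ranges over all paths, and each has the
    -- `p`-free level `suc t` as its witness.
    gap⇒⊨ᵏ t wt≡N = run zero , λ (π , _ , ¬known) →
      ¬known (suc t , s≤s z≤n , (λ π' _ → absent π') , λ _ _ _ → tt)
      where
      absent : (π : InitPath K) → ¬ p ∈ valuation (proj₁ π (suc t))
      absent π p∈ with j , on ← branch π =
        label-other (λ e → <-irrefl (trans (sym e) wt≡N) (toℕ<n j))
          (subst (p ∈_) (label-on {π} on t) p∈)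

    -- At every level below the root the branch named by the letter carries `p`, and the blind agent
    -- cannot exclude that branch.
    no-gap⇒⊭ᵏ : (∀ t → w t < N) → ¬ (K , blind ⊨ᵏ ∀ᵏ (eventuallyKnown¬ p))
    no-gap⇒⊭ᵏ w<N (π , ¬∃¬) = ¬∃¬ (π , (λ _ _ → refl) , λ { (suc t , _ , known , _) →
      known (run (fromℕ< (w<N t))) (λ _ _ → trans (∩-zeroʳ _) (sym (∩-zeroʳ _)))
        (subst (p ∈_) (sym (valuation-at (fromℕ< (w<N t)) t))
          (label-own (sym (toℕ-fromℕ< (w<N t))))) })

-- Separation of the KLTL sentence from every HyperCTL* sentence.

-- The words for the letters N, which belongs to no branch, and 0 are indistinguishable for φ; of
-- the two structures take the one on which φ is wrong.
separates : ∀ {n} (p : Fin n) (φ : HForm n 0) → Σ[ K ∈ Kripke n ]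
  (IsFinite K × ¬ ((K ⊨ʰ φ) ⇔ (K , blind ⊨ᵏ ∀ᵏ (eventuallyKnown¬ p))))
separates {n} p φ = choose (any? (λ c → sat₀? (suc s) 0 φ (n≤1+n s) ≤-refl noVars c))
  where
  s = temporalDepth φ
  -- `N` becomes `quantifierDepth φ + 2`, the least value with `1 + quantifierDepth φ < N`.
  open Words (suc (quantifierDepth φ))
  open Branches p (suc (quantifierDepth φ))
  word : ℕ → ℕ → ℕ
  -- One level more than the temporal depth, as `transfer-start` demands.
  word a = toeplitz (suc s) (const a)
  module M (a : ℕ) = Structure (word a) (size-1 (suc s)) (toeplitz-periodic (suc s) a)
  choose : Dec (∃[ c ] sat₀ (word 0) φ noVars c) → Σ[ K ∈ Kripke n ]
    (IsFinite K × ¬ ((K ⊨ʰ φ) ⇔ (K , blind ⊨ᵏ ∀ᵏ (eventuallyKnown¬ p))))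
  choose (yes φ₀) = M.K 0 , M.finite 0 , λ eq →
    M.no-gap⇒⊭ᵏ 0 (toeplitz-< (suc s) (λ _ → s≤s z≤n)) (Equivalence.to eq (M.sat₀⇒⊨ʰ 0 φ φ₀))
  choose (no ¬φ₀) = M.K N , M.finite N , λ eq →
    ¬φ₀ (map₂ (sat₀-transfer s φ ≤-refl ≤-refl noVars _ (const N) (const 0))
      (M.⊨ʰ⇒sat₀ N φ (Equivalence.from eq
        (M.gap⇒⊨ᵏ N (hole (suc s) 0) (toeplitz-hole (suc s) (const N) 0)))))

theorem3 : (n : ℕ) → (p : Fin n) →
    Σ[ k ∈ ℕ ] Σ[ ψ ∈ KForm k n ] (IsKLTL ψ × Σ[ Obs ∈ Observation k n ]
    ((φ : HForm n 0) → Guarded φ →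
    Σ[ K ∈ Kripke n ] (IsFinite K × ¬ ((K ⊨ʰ φ) ⇔ (K , Obs ⊨ᵏ ψ)))))
theorem3 n p =
  1 , ∀ᵏ (eventuallyKnown¬ p) ,
  (eventuallyKnown¬ p , Xᵖ (Uᵖ ⊤ᵖ (Kᵖ zero (¬ᵖ (atomᵖ p)))) , refl) ,
  blind , λ φ _ → separates p φ
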